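{- Let $n,k$ be positive integers with $k<n$. For integers $N\ge 1$ and $j$, let $\mathrm{Inc}_j(2\times N)$ be the set of $2\times N$ arrays of positive integers with strictly increasing rows and strictly increasing columns whose set of entries is exactly $\{1,\ldots,2N-j\}$ (this set is empty if $j<0$), and let $\mathrm{RInc}_j(2\times N)$ be the set of $2\times N$ arrays of positive integers with strictly increasing rows, weakly increasing columns (top entry $\le$ bottom entry), and set of entries exactly $\{1,\ldots,2N-j\}$. Put $S_q(N,j)=\sum_{T\in\mathrm{Inc}_j(2\times N)}q^{\mathrm{maj}(T)}$ and $R_q(N,j)=\sum_{T\in\mathrm{RInc}_j(2\times N)}q^{\mathrm{maj}(T)}$. Then \[ R_q(n,k)=S_q(n,k)+S_q(n,k-1)+(1-q^{2n-k})\bigl(S_q(n-1,k-1)+S_q(n-1,k-2)\bigr). \]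
   Context: Rows are numbered from top (row 1) to bottom (row 2). For a two-row array $T$, an integer $i$ is a descent of $T$ if $i$ occurs in row 1 and $i+1$ occurs in row 2; $\mathrm{maj}(T)$ is the sum of all descents of $T$. An empty sum is $0$. -}

module Defs where

open import Data.Bool using (Bool; true; false; _∧_; _∨_; if_then_else_)
open import Data.Nat using (ℕ; zero; suc; _+_; _*_; _⊔_; _<ᵇ_; _≡ᵇ_)
open import Data.Integer using (ℤ; +_; -[1+_]) renaming (_-_ to _-ℤ_)
open import Data.List using (List; []; _∷_; map; filter; concatMap; foldr)
open import Data.Vec using (Vec; []; _∷_; toList)
open import Data.Product using (_×_; _,_)
open import Relation.Nullary.Decidable using (Dec; yes; no)
open import Data.Bool.Properties using (T?)
open import Algebra.Bundles using (CommutativeRing)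
open import Level using (Level)

-- A 2 × N array, given as (row 1 , row 2); row 1 is the top row.
Array : ℕ → Set
Array N = Vec ℕ N × Vec ℕ N

range1 : ℕ → List ℕ
range1 zero    = []
range1 (suc M) = go 1 M
  where
  go : ℕ → ℕ → List ℕ
  go i zero    = i ∷ []
  go i (suc m) = i ∷ go (suc i) m

allVecs : ℕ → (N : ℕ) → List (Vec ℕ N)
allVecs M zero    = [] ∷ []
allVecs M (suc N) = concatMap (λ x → map (x ∷_) (allVecs M N)) (range1 M)

allArrays : ℕ → (N : ℕ) → List (Array N)
allArrays M N = concatMap (λ r₁ → map (r₁ ,_) (allVecs M N)) (allVecs M N)

mem : ℕ → List ℕ → Bool
mem x []       = false
mem x (y ∷ ys) = (x ≡ᵇ y) ∨ mem x ys

allB : {A : Set} → (A → Bool) → List A → Bool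
allB p []       = true
allB p (x ∷ xs) = p x ∧ allB p xs

strictInc : {N : ℕ} → Vec ℕ N → Bool
strictInc []           = true
strictInc (x ∷ [])     = true
strictInc (x ∷ y ∷ xs) = (x <ᵇ y) ∧ strictInc (y ∷ xs)

colsStrict : {N : ℕ} → Vec ℕ N → Vec ℕ N → Bool
colsStrict []       []       = true
colsStrict (x ∷ xs) (y ∷ ys) = (x <ᵇ y) ∧ colsStrict xs ys

colsWeak : {N : ℕ} → Vec ℕ N → Vec ℕ N → Bool
colsWeak []       []       = true
colsWeak (x ∷ xs) (y ∷ ys) = ((x <ᵇ y) ∨ (x ≡ᵇ y)) ∧ colsWeak xs ys

entries : {N : ℕ} → Array N → List ℕ
entries (r₁ , r₂) = toList r₁ Data.List.++ toList r₂

entrySetIs : {N : ℕ} → ℕ → Array N → Bool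
entrySetIs M T =
  allB (λ x → mem x (range1 M)) (entries T) ∧ allB (λ i → mem i (entries T)) (range1 M)

isInc : {N : ℕ} → ℕ → Array N → Bool
isInc M T@(r₁ , r₂) = strictInc r₁ ∧ strictInc r₂ ∧ colsStrict r₁ r₂ ∧ entrySetIs M T

isRInc : {N : ℕ} → ℕ → Array N → Bool
isRInc M T@(r₁ , r₂) = strictInc r₁ ∧ strictInc r₂ ∧ colsWeak r₁ r₂ ∧ entrySetIs M T

-- Inc_j(2×N) and RInc_j(2×N) as explicit lists (set of entries {1,…,2N−j};
-- empty when 2N − j < 0, since arrays have positive entries)
Inc : (N : ℕ) → ℤ → List (Array N)
Inc N j with (+ (2 * N)) -ℤ j
... | + M      = filter (λ T → T? (isInc M T)) (allArrays M N)
... | -[1+ _ ] = []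

RInc : (N : ℕ) → ℤ → List (Array N)
RInc N j with (+ (2 * N)) -ℤ j
... | + M      = filter (λ T → T? (isRInc M T)) (allArrays M N)
... | -[1+ _ ] = []

-- maj(T) = sum of the descents i (i in row 1, i+1 in row 2); every
-- descent is ≤ the largest entry of row 1, so summing over 1..max suffices.
maj : {N : ℕ} → Array N → ℕ
maj (r₁ , r₂) =
  foldr _+_ 0 (map (λ i → if mem i (toList r₁) ∧ mem (suc i) (toList r₂) then i else 0)
                   (range1 (foldr _⊔_ 0 (toList r₁))))

module _ {c ℓ : Level} (R : CommutativeRing c ℓ) where
  open CommutativeRing R using (Carrier; 1#; 0#) renaming (_+_ to _+R_; _*_ to _*R_)

  pow : Carrier → ℕ → Carrier
  pow q zero    = 1#
  pow q (suc m) = q *R pow q m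

  sumR : List Carrier → Carrier
  sumR = foldr _+R_ 0#

  Sq : Carrier → ℕ → ℤ → Carrier
  Sq q N j = sumR (map (λ T → pow q (maj T)) (Inc N j))

  Rq : Carrier → ℕ → ℤ → Carrier
  Rq q N j = sumR (map (λ T → pow q (maj T)) (RInc N j))

{-# OPTIONS --safe #-}

-- Record an array by the word whose i-th letter says whether i lies in row 1
-- only (up), in row 2 only (down) or in both rows (flat).  RInc becomes the set
-- of Motzkin paths, Inc the set of those without flat step at height 0, and i is
-- a descent iff letter i is not down and letter i + 1 is not up.
-- Let Z(M,h,b) be the sum of q^maj over the paths of length M that end at height
-- h with b entries in row 2, and W(M,h,b) the same sum after appending a down
-- step to each path.  Both satisfy a linear recurrence in M, which for the two
-- kinds of paths differs at h = 0 only.  Since Z = W at height 0 for strict paths,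
--   Z_weak(M,h,b) = Z_strict(M,h,b) + Z_strict(M,h+1,b-1)
-- follows by induction on M, together with the same identity for W.  The theorem
-- is the case h = 0, with Z_strict(M,1,n-1) expanded by the recurrence.
module Submission where

open import Defs
open import Level using (Level)
open import Data.Nat using (ℕ; zero; suc; _<_; _≤_; _∸_; _⊔_; z≤n; s≤s; _≡ᵇ_; _<ᵇ_) renaming (_*_ to _*ℕ_; _+_ to _+ℕ_)
open import Data.Nat.Properties using (≤-refl; ≤-trans; ≤-<-trans; <-trans; <⇒≤; <⇒≢; <-irrefl; m≤n⇒m≤1+n; m<1+n⇒m≤n; m≤n⇒m<n∨m≡n; n≤1+n; m≤m+n; m≤n+m; +-suc; *-suc; +-∸-assoc; m∸n+n≡m; suc-injective; ⊔-lub; m≤m⊔n; m≤n⊔m; <ᵇ⇒<; <⇒<ᵇ; ≡ᵇ⇒≡; ≡⇒≡ᵇ) renaming (+-comm to +ℕ-comm; +-identityʳ to +ℕ-identityʳ)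
open import Data.Nat.ListAction using (sum)
open import Data.Nat.ListAction.Properties using (sum-++)
open import Data.Integer using (+_) renaming (_-_ to _-ℤ_; _+_ to _+ℤ_)
open import Data.Integer.Properties using (pos-+)
open import Data.Integer.Tactic.RingSolver using (solve-∀)
open import Data.Bool using (Bool; true; false; T; _∧_; _∨_; if_then_else_)
open import Data.Bool.Properties using (T-∧; T-∨; T-≡; T?; ¬-not; ∧-zeroʳ)
open import Data.Empty using (⊥-elim)
open import Data.List using (List; []; _∷_; _++_; _∷ʳ_; map; filter; concatMap; foldr; length; applyUpTo; cartesianProductWith)
open import Data.List.Properties using (length-++; ∷ʳ-injective; map-++; map-∘; map-cong; applyUpTo-∷ʳ)
open import Data.List.Membership.Propositional using (_∈_; _∉_)
open import Data.List.Membership.Propositional.Properties using (∈-applyUpTo⁺; ∈-applyUpTo⁻; ∈-++⁺ˡ; ∈-++⁺ʳ; ∈-++⁻; ∈-map⁺; ∈-map⁻; ∈-filter⁺; ∈-filter⁻; ∈-cartesianProductWith⁺)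
open import Data.List.Membership.Propositional.Properties.WithK using (unique∧set⇒bag)
open import Data.List.Relation.Binary.BagAndSetEquality using (∼bag⇒↭)
open import Data.List.Relation.Binary.Permutation.Propositional using (_↭_; ↭⇒↭ₛ′)
import Data.List.Relation.Binary.Permutation.Propositional.Properties as ↭
import Data.List.Relation.Binary.Permutation.Setoid.Properties as ↭ₛ
open import Data.List.Relation.Unary.All as All using (All; []; _∷_)
open import Data.List.Relation.Unary.All.Properties using (∷ʳ⁺; ∷ʳ⁻; ++⁻; ++⁺)
open import Data.List.Relation.Unary.AllPairs using (AllPairs; []; _∷_)
import Data.List.Relation.Unary.AllPairs.Properties as AllPairs
open import Data.List.Relation.Unary.Any using (here; there)
open import Data.List.Relation.Unary.Linked using (Linked; []; [-]; _∷_)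
open import Data.List.Relation.Unary.Linked.Properties using (Linked⇒AllPairs; AllPairs⇒Linked)
open import Data.List.Relation.Unary.Unique.Propositional using (Unique)
import Data.List.Relation.Unary.Unique.Propositional.Properties as Unique
open import Data.Product as Product using (∃; _×_; _,_; proj₁; proj₂)
open import Data.Product.Properties using (,-injective)
open import Data.Sum as Sum using (_⊎_; inj₁; inj₂)
open import Data.Vec using (Vec; []; _∷_; toList; fromList; head)
open import Data.Vec.Properties using (toList-injective; toList∘fromList; length-toList; cast-is-id; ∷-injective)
open import Function using (_∘_; id; _⇔_; mk⇔; Equivalence)
open import Relation.Nullary using (contradiction)
open import Relation.Binary.PropositionalEquality using (_≡_; _≢_; refl; sym; trans; cong; cong₂; subst; subst₂)
open import Algebra.Bundles using (CommutativeRing)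
open Equivalence using (to; from)

-- The where-bound worker of range1 cannot be named; unification recovers it once
-- both of its literal arguments have been abstracted.
mutual
  run : ℕ → ℕ → ℕ → List ℕ
  run = _

  range1-run : ∀ m → range1 (suc (suc m)) ≡ 1 ∷ run (suc m) 2 m
  range1-run m with suc m | 2
  ... | _ | _ = refl

-- The start of the run moves in the recursion, so the statement is about any progression `f` of
-- step 1. `p` is the variable of the enclosing clause of `range1`, which the worker carries along.
run-applyUpTo : ∀ (f : ℕ → ℕ) p m → (∀ j → f (suc j) ≡ suc (f j)) →
  run p (f 0) m ≡ applyUpTo f (suc m)
run-applyUpTo f p zero fs = refl
run-applyUpTo f p (suc m) fs =
  cong (f 0 ∷_) (trans (cong (λ i → run p i m) (sym (fs 0))) (run-applyUpTo (f ∘ suc) p m (fs ∘ suc)))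

range1≡applyUpTo : ∀ M → range1 M ≡ applyUpTo suc M
range1≡applyUpTo zero = refl
range1≡applyUpTo (suc zero) = refl
range1≡applyUpTo (suc (suc m)) =
  trans (range1-run m) (cong (1 ∷_) (run-applyUpTo (suc ∘ suc) (suc m) m (λ _ → refl)))

InRange : ℕ → ℕ → Set
InRange M x = 0 < x × x ≤ M

∈-range1 : ∀ {M x} → x ∈ range1 M ⇔ InRange M x
∈-range1 {M} {x} = mk⇔ there′ back
  where
  there′ : x ∈ range1 M → InRange M x
  there′ x∈ with ∈-applyUpTo⁻ suc (subst (x ∈_) (range1≡applyUpTo M) x∈)
  ... | _ , i<M , refl = s≤s z≤n , i<M
  back : InRange M x → x ∈ range1 M
  back (s≤s _ , x≤M) = subst (x ∈_) (sym (range1≡applyUpTo M)) (∈-applyUpTo⁺ suc x≤M)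

range1-unique : ∀ M → Unique (range1 M)
range1-unique M = subst Unique (sym (range1≡applyUpTo M))
  (Unique.applyUpTo⁺₁ suc M (λ i<j _ e → <-irrefl (suc-injective e) i<j))

-- Motzkin words and their major index

data Kind : Set where
  strict weak : Kind

data Step : Set where
  up down flat : Step

-- Written backwards: the head of a word of length M is its letter M.
Word : ℕ → Set
Word = Vec Step

-- The descent created by appending a letter that occurs in row 2 (0 if none).
endTop : ∀ {M} → Word M → ℕ
endTop []              = 0
endTop (down ∷ w)      = 0
endTop {suc M} (_ ∷ w) = suc M

-- Each descent is charged to the letter after it: a letter that occurs in row 2 closes a descent
-- exactly when its predecessor occurs in row 1.
majW : ∀ {M} → Word M → ℕ
majW []       = 0
majW (up ∷ w) = majW w
majW (_ ∷ w)  = endTop w +ℕ majW w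

-- Paths of length M from height 0 to height h with b letters other than up.
mutual
  paths : Kind → (M h b : ℕ) → List (Word M)
  paths s zero zero    zero    = [] ∷ []
  paths s zero zero    (suc b) = []
  paths s zero (suc h) b       = []
  paths s (suc M) h b = (endUp s M h b ++ endFlat s M h b) ++ endDown s M h b

  endUp : Kind → (M h b : ℕ) → List (Word (suc M))
  endUp s M zero    b = []
  endUp s M (suc h) b = map (up ∷_) (paths s M h b)

  -- At height 0 the rows are equally long, so a flat step there puts one number twice into the same
  -- column. Strict columns forbid this.
  endFlat : Kind → (M h b : ℕ) → List (Word (suc M))
  endFlat s      M h       zero    = []
  endFlat strict M zero    (suc b) = []
  endFlat strict M (suc h) (suc b) = map (flat ∷_) (paths strict M (suc h) b)
  endFlat weak   M h       (suc b) = map (flat ∷_) (paths weak M h b)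

  endDown : Kind → (M h b : ℕ) → List (Word (suc M))
  endDown s M h zero    = []
  endDown s M h (suc b) = map (down ∷_) (paths s M (suc h) b)

-- Words and pairs of rows

top bot : ∀ {M} → Word M → List ℕ
top []                 = []
top (down ∷ w)         = top w
top {suc M} (_ ∷ w)    = top w ∷ʳ suc M
bot []                 = []
bot (up ∷ w)           = bot w
bot {suc M} (_ ∷ w)    = bot w ∷ʳ suc M

rel : Kind → ℕ → ℕ → Set
rel strict = _<_
rel weak   = _≤_

-- Row 2 may be shorter than row 1, because the entries up to some bound in an array form two rows
-- of different lengths.
data Cols (s : Kind) : List ℕ → List ℕ → Set where
  []  : ∀ {xs} → Cols s xs []
  _∷_ : ∀ {x y xs ys} → rel s x y → Cols s xs ys → Cols s (x ∷ xs) (y ∷ ys)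

<⇒rel : ∀ s {x y} → x < y → rel s x y
<⇒rel strict = id
<⇒rel weak   = <⇒≤

rel⇒≤ : ∀ s {x y} → rel s x y → x ≤ y
rel⇒≤ strict = <⇒≤
rel⇒≤ weak   = id

module _ {s : Kind} where

  cols-∷ʳˡ : ∀ {xs ys m} → Cols s xs ys → Cols s (xs ∷ʳ m) ys
  cols-∷ʳˡ []       = []
  cols-∷ʳˡ (r ∷ rs) = r ∷ cols-∷ʳˡ rs

  -- As row 2 is shorter, `m` lands below some entry of row 1. Which one is immaterial, since all of
  -- them are related to `m`.
  cols-∷ʳʳ : ∀ {xs ys m} → All (λ x → rel s x m) xs → length ys < length xs →
    Cols s xs ys → Cols s xs (ys ∷ʳ m)
  cols-∷ʳʳ (p ∷ _)  l       []       = p ∷ []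
  cols-∷ʳʳ (_ ∷ ps) (s≤s l) (r ∷ rs) = r ∷ cols-∷ʳʳ ps l rs

  -- Nothing stands below the deleted `m`, for an entry there would be at least `m`.
  cols-initˡ : ∀ xs {ys m} → All (_< m) ys → Cols s (xs ∷ʳ m) ys → Cols s xs ys
  cols-initˡ xs       []       []       = []
  cols-initˡ []       (p ∷ _)  (r ∷ _)  = contradiction (≤-<-trans (rel⇒≤ s r) p) (<-irrefl refl)
  cols-initˡ (x ∷ xs) (_ ∷ ps) (r ∷ rs) = r ∷ cols-initˡ xs ps rs

  cols-initʳ : ∀ {xs} ys {m} → Cols s xs (ys ∷ʳ m) → Cols s xs ys × length ys < length xs
  cols-initʳ []       (_ ∷ _)  = [] , s≤s z≤n
  cols-initʳ (y ∷ ys) (r ∷ rs) with cols-initʳ ys rs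
  ... | rs′ , l = r ∷ rs′ , s≤s l

  cols-length : ∀ {xs ys} → Cols s xs ys → length ys ≤ length xs
  cols-length []       = z≤n
  cols-length (_ ∷ rs) = s≤s (cols-length rs)

-- The two copies of `m` cannot share a column, as `m < m` fails, so the lower one stands further
-- left. This is what excludes a strict flat step at height 0.
cols-init² : ∀ xs ys {m} → Cols strict (xs ∷ʳ m) (ys ∷ʳ m) → length ys < length xs
cols-init² []       []       (m<m ∷ _) = contradiction m<m (<-irrefl refl)
cols-init² []       (_ ∷ []) (_ ∷ ())
cols-init² []       (_ ∷ _ ∷ _) (_ ∷ ())
cols-init² (_ ∷ xs) []       _        = s≤s z≤n
cols-init² (_ ∷ xs) (_ ∷ ys) (_ ∷ rs) = s≤s (cols-init² xs ys rs)

-- The conditions of `Inc` and `RInc` for rows of possibly different lengths, so that they survive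
-- the deletion of the largest entry.
record Valid (s : Kind) (M : ℕ) (xs ys : List ℕ) : Set where
  constructor valid
  field
    incˡ   : AllPairs _<_ xs
    incʳ   : AllPairs _<_ ys
    cols   : Cols s xs ys
    boundˡ : All (InRange M) xs
    boundʳ : All (InRange M) ys
    cover  : ∀ {i} → InRange M i → i ∈ xs ⊎ i ∈ ys

-- An inductive form of membership in `paths`, which allows recursion along the word. The height `h`
-- is the excess of row 1 over row 2 in length.
data Path : Kind → ∀ {M} → ℕ → ℕ → Word M → Set where
  ε     : ∀ {s} → Path s 0 0 []
  up    : ∀ {s M h b} {w : Word M} → Path s h b w → Path s (suc h) b (up ∷ w)
  down  : ∀ {s M h b} {w : Word M} → Path s (suc h) b w → Path s h (suc b) (down ∷ w)
  flatˢ : ∀ {M h b} {w : Word M} → Path strict (suc h) b w → Path strict (suc h) (suc b) (flat ∷ w)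
  flatʷ : ∀ {M h b} {w : Word M} → Path weak h b w → Path weak h (suc b) (flat ∷ w)

Path⇒∈paths : ∀ {s M h b} {w : Word M} → Path s h b w → w ∈ paths s M h b
Path⇒∈paths ε = here refl
Path⇒∈paths (up p) = ∈-++⁺ˡ (∈-++⁺ˡ (∈-map⁺ (up ∷_) (Path⇒∈paths p)))
Path⇒∈paths {s} {suc M} {h} {b} (down p) =
  ∈-++⁺ʳ (endUp s M h b ++ endFlat s M h b) (∈-map⁺ (down ∷_) (Path⇒∈paths p))
Path⇒∈paths {s} {suc M} {h} {b} (flatˢ p) =
  ∈-++⁺ˡ (∈-++⁺ʳ (endUp s M h b) (∈-map⁺ (flat ∷_) (Path⇒∈paths p)))
Path⇒∈paths {s} {suc M} {h} {b} (flatʷ p) =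
  ∈-++⁺ˡ (∈-++⁺ʳ (endUp s M h b) (∈-map⁺ (flat ∷_) (Path⇒∈paths p)))

∈paths⇒Path : ∀ s M h b {w : Word M} → w ∈ paths s M h b → Path s h b w
∈paths⇒Path s zero    zero zero (here refl) = ε
∈paths⇒Path s (suc M) h    b    w∈
  with ∈-++⁻ (endUp s M h b ++ endFlat s M h b) w∈
∈paths⇒Path s (suc M) h (suc b) w∈ | inj₂ w∈′ with ∈-map⁻ (down ∷_) w∈′
... | _ , v∈ , refl = down (∈paths⇒Path s M (suc h) b v∈)
∈paths⇒Path s (suc M) h b w∈ | inj₁ w∈′ with ∈-++⁻ (endUp s M h b) w∈′
∈paths⇒Path s (suc M) (suc h) b w∈ | inj₁ _ | inj₁ w∈″ with ∈-map⁻ (up ∷_) w∈″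
... | _ , v∈ , refl = up (∈paths⇒Path s M h b v∈)
∈paths⇒Path strict (suc M) (suc h) (suc b) w∈ | inj₁ _ | inj₂ w∈″ with ∈-map⁻ (flat ∷_) w∈″
... | _ , v∈ , refl = flatˢ (∈paths⇒Path strict M (suc h) b v∈)
∈paths⇒Path weak (suc M) h (suc b) w∈ | inj₁ _ | inj₂ w∈″ with ∈-map⁻ (flat ∷_) w∈″
... | _ , v∈ , refl = flatʷ (∈paths⇒Path weak M h b v∈)

-- The three families of words differ in their head letter, and within each family consing is
-- injective.
paths-unique : ∀ s M h b → Unique (paths s M h b)
paths-unique s zero zero    zero    = [] ∷ []
paths-unique s zero zero    (suc b) = []
paths-unique s zero (suc h) b       = []
paths-unique s (suc M) h b =
  Unique.++⁺
    (Unique.++⁺ (ups h) (flats s h b) (λ (p , p′) → case-≢ (up-head h p) (flat-head s h b p′) λ ()))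
    (downs b) λ (p , p′) → Sum.[ (λ p → case-≢ (up-head h p) (down-head b p′) λ ())
                               , (λ p → case-≢ (flat-head s h b p) (down-head b p′) λ ()) ]′
                               (∈-++⁻ (endUp s M h b) p)
  where
  case-≢ : {A B : Set} {x y z : A} → x ≡ y → x ≡ z → y ≢ z → B
  case-≢ e e′ n = contradiction (trans (sym e) e′) n
  cons-unique : ∀ l {ws : List (Word M)} → Unique ws → Unique (map (l ∷_) ws)
  cons-unique l = Unique.map⁺ (proj₂ ∘ ∷-injective)
  cons-head : ∀ l {ws : List (Word M)} {w} → w ∈ map (l ∷_) ws → head w ≡ l
  cons-head l p with ∈-map⁻ (l ∷_) p
  ... | _ , _ , refl = refl
  ups : ∀ h → Unique (endUp s M h b)
  ups zero    = []
  ups (suc h) = cons-unique up (paths-unique s M h b)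
  flats : ∀ s h b → Unique (endFlat s M h b)
  flats s      h       zero    = []
  flats strict zero    (suc b) = []
  flats strict (suc h) (suc b) = cons-unique flat (paths-unique strict M (suc h) b)
  flats weak   h       (suc b) = cons-unique flat (paths-unique weak M h b)
  downs : ∀ b → Unique (endDown s M h b)
  downs zero    = []
  downs (suc b) = cons-unique down (paths-unique s M (suc h) b)
  up-head : ∀ h {w} → w ∈ endUp s M h b → head w ≡ up
  up-head (suc h) = cons-head up
  flat-head : ∀ s h b {w} → w ∈ endFlat s M h b → head w ≡ flat
  flat-head strict (suc h) (suc b) = cons-head flat
  flat-head weak   h       (suc b) = cons-head flat
  down-head : ∀ b {w} → w ∈ endDown s M h b → head w ≡ down
  down-head (suc b) = cons-head down

InRange-suc : ∀ {M x} → InRange M x → InRange (suc M) x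
InRange-suc (p , q) = p , m≤n⇒m≤1+n q

top-bound : ∀ {M} (w : Word M) → All (InRange M) (top w)
top-bound []         = []
top-bound (down ∷ w) = All.map InRange-suc (top-bound w)
top-bound (up ∷ w)   = ∷ʳ⁺ (All.map InRange-suc (top-bound w)) (s≤s z≤n , ≤-refl)
top-bound (flat ∷ w) = ∷ʳ⁺ (All.map InRange-suc (top-bound w)) (s≤s z≤n , ≤-refl)

bot-bound : ∀ {M} (w : Word M) → All (InRange M) (bot w)
bot-bound []         = []
bot-bound (up ∷ w)   = All.map InRange-suc (bot-bound w)
bot-bound (down ∷ w) = ∷ʳ⁺ (All.map InRange-suc (bot-bound w)) (s≤s z≤n , ≤-refl)
bot-bound (flat ∷ w) = ∷ʳ⁺ (All.map InRange-suc (bot-bound w)) (s≤s z≤n , ≤-refl)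

∷ʳ-inc : ∀ {M xs} → AllPairs _<_ xs → All (InRange M) xs → AllPairs _<_ (xs ∷ʳ suc M)
∷ʳ-inc inc bound = AllPairs.++⁺ inc ([] ∷ []) (All.map (λ (_ , x≤M) → s≤s x≤M ∷ []) bound)

top-inc : ∀ {M} (w : Word M) → AllPairs _<_ (top w)
top-inc []         = []
top-inc (down ∷ w) = top-inc w
top-inc (up ∷ w)   = ∷ʳ-inc (top-inc w) (top-bound w)
top-inc (flat ∷ w) = ∷ʳ-inc (top-inc w) (top-bound w)

bot-inc : ∀ {M} (w : Word M) → AllPairs _<_ (bot w)
bot-inc []         = []
bot-inc (up ∷ w)   = bot-inc w
bot-inc (down ∷ w) = ∷ʳ-inc (bot-inc w) (bot-bound w)
bot-inc (flat ∷ w) = ∷ʳ-inc (bot-inc w) (bot-bound w)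

InRange-pred : ∀ {M i} → InRange (suc M) i → InRange M i ⊎ i ≡ suc M
InRange-pred (0<i , i≤1+M) = Sum.map₁ (λ i<1+M → 0<i , m<1+n⇒m≤n i<1+M) (m≤n⇒m<n∨m≡n i≤1+M)

last∈ : {A : Set} {x : A} (xs : List A) → x ∈ xs ∷ʳ x
last∈ xs = ∈-++⁺ʳ xs (here refl)

word-cover : ∀ {M} (w : Word M) {i} → InRange M i → i ∈ top w ⊎ i ∈ bot w
word-cover [] (s≤s _ , ())
word-cover (l ∷ w) r with InRange-pred r
word-cover (up ∷ w)   r | inj₂ refl = inj₁ (last∈ (top w))
word-cover (down ∷ w) r | inj₂ refl = inj₂ (last∈ (bot w))
word-cover (flat ∷ w) r | inj₂ refl = inj₁ (last∈ (top w))
word-cover (up ∷ w)   r | inj₁ r′   = Sum.map₁ ∈-++⁺ˡ (word-cover w r′)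
word-cover (down ∷ w) r | inj₁ r′   = Sum.map₂ ∈-++⁺ˡ (word-cover w r′)
word-cover (flat ∷ w) r | inj₁ r′   = Sum.map ∈-++⁺ˡ ∈-++⁺ˡ (word-cover w r′)

length-∷ʳ : {A : Set} {x : A} (xs : List A) → length (xs ∷ʳ x) ≡ suc (length xs)
length-∷ʳ xs = trans (length-++ xs) (+ℕ-comm (length xs) 1)

bot-length : ∀ {s M h b} {w : Word M} → Path s h b w → length (bot w) ≡ b
bot-length ε = refl
bot-length (up p) = bot-length p
bot-length {w = _ ∷ w} (down p)  = trans (length-∷ʳ (bot w)) (cong suc (bot-length p))
bot-length {w = _ ∷ w} (flatˢ p) = trans (length-∷ʳ (bot w)) (cong suc (bot-length p))
bot-length {w = _ ∷ w} (flatʷ p) = trans (length-∷ʳ (bot w)) (cong suc (bot-length p))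

top-length : ∀ {s M h b} {w : Word M} → Path s h b w → length (top w) ≡ h +ℕ b
top-length ε = refl
top-length {w = _ ∷ w} (up p) = trans (length-∷ʳ (top w)) (cong suc (top-length p))
top-length {h = h} {b = suc b} {w = _ ∷ w} (down p)  = trans (top-length p) (sym (+-suc h b))
top-length {h = h} {b = suc b} {w = _ ∷ w} (flatˢ p) =
  trans (length-∷ʳ (top w)) (trans (cong suc (top-length p)) (sym (+-suc h b)))
top-length {h = h} {b = suc b} {w = _ ∷ w} (flatʷ p) =
  trans (length-∷ʳ (top w)) (trans (cong suc (top-length p)) (sym (+-suc h b)))

bot<top : ∀ {s M h b} {w : Word M} → Path s (suc h) b w → length (bot w) < length (top w)
bot<top {h = h} {b = b} p = subst₂ _<_ (sym (bot-length p)) (sym (top-length p)) (s≤s (m≤n+m b h))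

bot≤top : ∀ {s M h b} {w : Word M} → Path s h b w → length (bot w) ≤ length (top w)
bot≤top {h = h} {b = b} p = subst₂ _≤_ (sym (bot-length p)) (sym (top-length p)) (m≤n+m b h)

path-cols : ∀ {s M h b} {w : Word M} → Path s h b w → Cols s (top w) (bot w)
path-cols ε = []
path-cols (up p) = cols-∷ʳˡ (path-cols p)
path-cols {s} {w = _ ∷ w} (down p) =
  cols-∷ʳʳ (All.map (λ (_ , x≤M) → <⇒rel s (s≤s x≤M)) (top-bound w)) (bot<top p) (path-cols p)
-- Row 2 grows first, so that the new entry is compared only with the smaller old entries of row 1.
-- The positive height leaves room for it.
path-cols {w = _ ∷ w} (flatˢ p) =
  cols-∷ʳˡ (cols-∷ʳʳ (All.map (λ (_ , x≤M) → s≤s x≤M) (top-bound w)) (bot<top p) (path-cols p))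
-- Row 1 grows first: at height 0 the new entry of row 2 lands below its own copy, which weak
-- columns permit.
path-cols {w = _ ∷ w} (flatʷ p) =
  cols-∷ʳʳ (All.map proj₂ (top-bound (flat ∷ w)))
    (subst (length (bot w) <_) (sym (length-∷ʳ (top w))) (s≤s (bot≤top p)))
    (cols-∷ʳˡ (path-cols p))

path-valid : ∀ {s M h b} {w : Word M} → Path s h b w → Valid s M (top w) (bot w)
path-valid {w = w} p =
  valid (top-inc w) (bot-inc w) (path-cols p) (top-bound w) (bot-bound w) (word-cover w)

-- Deleting the largest entry

SplitMax : ℕ → List ℕ → Set
SplitMax M xs =
  (∃ λ xs′ → xs ≡ xs′ ∷ʳ suc M × AllPairs _<_ xs′ × All (InRange M) xs′) ⊎ All (InRange M) xs

-- In an increasing row bounded by `suc M`, only the last entry can equal `suc M`.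
splitMax : ∀ {M xs} → AllPairs _<_ xs → All (InRange (suc M)) xs → SplitMax M xs
splitMax [] [] = inj₂ []
splitMax {M} {x ∷ xs} (x<xs ∷ inc) ((0<x , x≤1+M) ∷ bound) with splitMax inc bound
... | inj₁ (xs′ , refl , inc′ , bound′) =
  inj₁ (x ∷ xs′ , refl , proj₁ (∷ʳ⁻ x<xs) ∷ inc′ ,
        (0<x , m<1+n⇒m≤n (proj₂ (∷ʳ⁻ {xs = xs′} x<xs))) ∷ bound′)
splitMax (x<xs ∷ inc) (r ∷ bound) | inj₂ [] with InRange-pred r
... | inj₁ r′   = inj₂ (r′ ∷ [])
... | inj₂ refl = inj₁ ([] , refl , [] , [])
splitMax ((x<y ∷ _) ∷ inc) ((0<x , _) ∷ bound) | inj₂ (y ∷ ys) =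
  inj₂ ((0<x , ≤-trans (<⇒≤ x<y) (proj₂ y)) ∷ y ∷ ys)

∈-init : ∀ {M i} xs → InRange M i → i ∈ xs ∷ʳ suc M → i ∈ xs
∈-init xs (_ , i≤M) i∈ with ∈-++⁻ xs i∈
... | inj₁ i∈xs        = i∈xs
... | inj₂ (here refl) = contradiction i≤M (<-irrefl refl)

max∉ : ∀ {M xs} → All (InRange M) xs → suc M ∉ xs
max∉ bound p = <-irrefl refl (proj₂ (All.lookup bound p))

module _ {M : ℕ} where

  init-up : ∀ {s xs ys} → All (InRange M) xs → All (InRange M) ys → AllPairs _<_ xs →
    Valid s (suc M) (xs ∷ʳ suc M) ys → Valid s M xs ys
  init-up {xs = xs} bx by ix (valid _ iy cols _ _ cover) =
    valid ix iy (cols-initˡ xs (All.map (s≤s ∘ proj₂) by) cols) bx by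
      λ r → Sum.map₁ (∈-init xs r) (cover (InRange-suc r))

  init-down : ∀ {s xs ys} → All (InRange M) xs → All (InRange M) ys → AllPairs _<_ ys →
    Valid s (suc M) xs (ys ∷ʳ suc M) → Valid s M xs ys
  init-down {ys = ys} bx by iy (valid ix _ cols _ _ cover) =
    valid ix iy (proj₁ (cols-initʳ ys cols)) bx by
      λ r → Sum.map₂ (∈-init ys r) (cover (InRange-suc r))

  init-flat : ∀ {s xs ys} → All (InRange M) xs → All (InRange M) ys →
    AllPairs _<_ xs → AllPairs _<_ ys →
    Valid s (suc M) (xs ∷ʳ suc M) (ys ∷ʳ suc M) → Valid s M xs ys
  init-flat {xs = xs} {ys} bx by ix iy (valid _ _ cols _ _ cover) =
    valid ix iy (cols-initˡ xs (All.map (s≤s ∘ proj₂) by) (proj₁ (cols-initʳ ys cols))) bx by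
      λ r → Sum.map (∈-init xs r) (∈-init ys r) (cover (InRange-suc r))

WordOf : Kind → (M h b : ℕ) → List ℕ → List ℕ → Set
WordOf s M h b xs ys = ∃ λ (w : Word M) → top w ≡ xs × bot w ≡ ys × Path s h b w

module _ {M : ℕ} where

  extend-up : ∀ {s h b xs ys} → WordOf s M h b xs ys → WordOf s (suc M) (suc h) b (xs ∷ʳ suc M) ys
  extend-up (w , refl , refl , p) = up ∷ w , refl , refl , up p

  extend-down : ∀ {s h b xs ys} → WordOf s M (suc h) b xs ys →
    WordOf s (suc M) h (suc b) xs (ys ∷ʳ suc M)
  extend-down (w , refl , refl , p) = down ∷ w , refl , refl , down p

  extend-flatˢ : ∀ {h b xs ys} → WordOf strict M (suc h) b xs ys →
    WordOf strict (suc M) (suc h) (suc b) (xs ∷ʳ suc M) (ys ∷ʳ suc M)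
  extend-flatˢ (w , refl , refl , p) = flat ∷ w , refl , refl , flatˢ p

  extend-flatʷ : ∀ {h b xs ys} → WordOf weak M h b xs ys →
    WordOf weak (suc M) h (suc b) (xs ∷ʳ suc M) (ys ∷ʳ suc M)
  extend-flatʷ (w , refl , refl , p) = flat ∷ w , refl , refl , flatʷ p

-- Induction on `M`: the rows that contain the largest entry determine the last letter, and deleting
-- that entry leaves valid rows for the shorter word.
valid⇒path : ∀ s M h b {xs ys} → Valid s M xs ys → length xs ≡ h +ℕ b → length ys ≡ b →
  WordOf s M h b xs ys
valid⇒path s zero h b {x ∷ xs} (valid _ _ _ ((s≤s _ , ()) ∷ _) _ _) _ _
valid⇒path s zero h b {[]} {y ∷ ys} (valid _ _ _ _ ((s≤s _ , ()) ∷ _) _) _ _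
valid⇒path s zero zero zero {[]} {[]} v ex refl = [] , refl , refl , ε
valid⇒path s (suc M) h b v@(valid incˡ incʳ cols boundˡ boundʳ cover) ex ey
  with splitMax incˡ boundˡ | splitMax incʳ boundʳ
valid⇒path s (suc M) h b v@(valid incˡ incʳ cols boundˡ boundʳ cover) ex ey
  | inj₂ bx | inj₂ by =
  ⊥-elim (Sum.[ max∉ bx , max∉ by ]′ (cover (s≤s z≤n , ≤-refl)))
-- The rows are equally long here, so deleting `suc M` from row 1 alone would leave row 2 the longer
-- one.
valid⇒path s (suc M) zero b v ex ey | inj₁ (xs , refl , ix , bx) | inj₂ by =
  contradiction (cols-length (Valid.cols (init-up bx by ix v)))
    (λ l → <-irrefl (trans ey (trans (sym ex) (length-∷ʳ xs))) (s≤s l))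
valid⇒path s (suc M) (suc h) b v ex ey | inj₁ (xs , refl , ix , bx) | inj₂ by =
  extend-up (valid⇒path s M h b (init-up bx by ix v) (suc-injective (trans (sym (length-∷ʳ xs)) ex)) ey)
valid⇒path s (suc M) h b v ex ey | inj₂ bx | inj₁ (ys , refl , iy , by)
  with refl ← trans (sym (length-∷ʳ ys)) ey =
  extend-down (valid⇒path s M (suc h) (length ys) (init-down bx by iy v) (trans ex (+-suc h _)) refl)
valid⇒path weak (suc M) h b v ex ey | inj₁ (xs , refl , ix , bx) | inj₁ (ys , refl , iy , by)
  with refl ← trans (sym (length-∷ʳ ys)) ey =
  extend-flatʷ (valid⇒path weak M h (length ys) (init-flat bx by ix iy v)
    (suc-injective (trans (sym (length-∷ʳ xs)) (trans ex (+-suc h _)))) refl)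
-- By `cols-init²` row 2 would be strictly shorter, but at height 0 the lengths agree.
valid⇒path strict (suc M) zero b v ex ey | inj₁ (xs , refl , ix , bx) | inj₁ (ys , refl , iy , by) =
  contradiction (cols-init² xs ys (Valid.cols v))
    (<-irrefl (suc-injective (trans (sym (length-∷ʳ ys)) (trans ey (trans (sym ex) (length-∷ʳ xs))))))
valid⇒path strict (suc M) (suc h) b v ex ey | inj₁ (xs , refl , ix , bx) | inj₁ (ys , refl , iy , by)
  with refl ← trans (sym (length-∷ʳ ys)) ey =
  extend-flatˢ (valid⇒path strict M (suc h) (length ys) (init-flat bx by ix iy v)
    (suc-injective (trans (sym (length-∷ʳ xs)) (trans ex (+-suc (suc h) _)))) refl)

-- Arrays as words

-- The test compares neighbours only; transitivity of `<` extends it to all pairs.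
T-strictInc : ∀ {N} (v : Vec ℕ N) → T (strictInc v) ⇔ AllPairs _<_ (toList v)
T-strictInc v = mk⇔ (Linked⇒AllPairs <-trans ∘ sound v) (complete v ∘ AllPairs⇒Linked)
  where
  sound : ∀ {N} (v : Vec ℕ N) → T (strictInc v) → Linked _<_ (toList v)
  sound []          _ = []
  sound (x ∷ [])    _ = [-]
  sound (x ∷ y ∷ v) t =
    <ᵇ⇒< x y (proj₁ (to T-∧ t)) ∷ sound (y ∷ v) (proj₂ (to (T-∧ {x <ᵇ y}) t))
  complete : ∀ {N} (v : Vec ℕ N) → Linked _<_ (toList v) → T (strictInc v)
  complete []          _         = _
  complete (x ∷ [])    _         = _
  complete (x ∷ y ∷ v) (x<y ∷ l) = from T-∧ (<⇒<ᵇ x<y , complete (y ∷ v) l)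

colsOK : ∀ {N} → Kind → Vec ℕ N → Vec ℕ N → Bool
colsOK strict = colsStrict
colsOK weak   = colsWeak

T-colsOK : ∀ s {N} (v w : Vec ℕ N) → T (colsOK s v w) ⇔ Cols s (toList v) (toList w)
T-colsOK s v w = mk⇔ (sound s v w) (complete s v w)
  where
  weak-sound : ∀ {x y} → x < y ⊎ x ≡ y → x ≤ y
  weak-sound (inj₁ x<y)  = <⇒≤ x<y
  weak-sound (inj₂ refl) = ≤-refl
  sound : ∀ s {N} (v w : Vec ℕ N) → T (colsOK s v w) → Cols s (toList v) (toList w)
  sound s []      []      t = []
  sound strict (x ∷ v) (y ∷ w) t with to T-∧ t
  ... | x<y , t′ = <ᵇ⇒< x y x<y ∷ sound strict v w t′
  sound weak (x ∷ v) (y ∷ w) t with to T-∧ t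
  ... | x≤y , t′ = weak-sound (Sum.map (<ᵇ⇒< x y) (≡ᵇ⇒≡ x y) (to T-∨ x≤y)) ∷ sound weak v w t′
  complete : ∀ s {N} (v w : Vec ℕ N) → Cols s (toList v) (toList w) → T (colsOK s v w)
  complete strict []      []      _        = _
  complete weak   []      []      _        = _
  complete strict (x ∷ v) (y ∷ w) (r ∷ rs) = from T-∧ (<⇒<ᵇ r , complete strict v w rs)
  complete weak   (x ∷ v) (y ∷ w) (r ∷ rs) =
    from T-∧ (from T-∨ (Sum.map <⇒<ᵇ (≡⇒≡ᵇ x y) (m≤n⇒m<n∨m≡n r)) , complete weak v w rs)

T-mem : ∀ {x} ys → T (mem x ys) ⇔ x ∈ ys
T-mem {x} ys = mk⇔ (sound ys) complete
  where
  sound : ∀ ys → T (mem x ys) → x ∈ ys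
  sound (y ∷ ys) t with to T-∨ t
  ... | inj₁ e  = here (≡ᵇ⇒≡ x y e)
  ... | inj₂ t′ = there (sound ys t′)
  complete : ∀ {ys} → x ∈ ys → T (mem x ys)
  complete (here e)  = from T-∨ (inj₁ (≡⇒≡ᵇ x _ e))
  complete {y ∷ _} (there p) = from (T-∨ {x ≡ᵇ y}) (inj₂ (complete p))

T-allB : {A : Set} {p : A → Bool} (xs : List A) → T (allB p xs) ⇔ All (T ∘ p) xs
T-allB {p = p} xs = mk⇔ (sound xs) complete
  where
  sound : ∀ xs → T (allB p xs) → All (T ∘ p) xs
  sound []       _ = []
  sound (x ∷ xs) t with to T-∧ t
  ... | px , t′ = px ∷ sound xs t′
  complete : ∀ {xs} → All (T ∘ p) xs → T (allB p xs)
  complete []         = _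
  complete (px ∷ pxs) = from T-∧ (px , complete pxs)

check : ∀ {N} → Kind → ℕ → Array N → Bool
check strict = isInc
check weak   = isRInc

rows : ∀ {N} → Array N → List ℕ × List ℕ
rows (r₁ , r₂) = toList r₁ , toList r₂

module _ {N : ℕ} (M : ℕ) (r₁ r₂ : Vec ℕ N) where

  -- `check s` unfolds to a conjunction only once `s` is a constructor, which is why each direction
  -- has two equal clauses.
  check-∧ : ∀ s → T (check s M (r₁ , r₂)) ⇔
    (T (strictInc r₁) × T (strictInc r₂) × T (colsOK s r₁ r₂) × T (entrySetIs M (r₁ , r₂)))
  check-∧ s = mk⇔ (fwd s) (bwd s)
    where
    fwd : ∀ s → T (check s M (r₁ , r₂)) →
      T (strictInc r₁) × T (strictInc r₂) × T (colsOK s r₁ r₂) × T (entrySetIs M (r₁ , r₂))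
    fwd strict = Product.map₂ (Product.map₂ (to T-∧) ∘ to T-∧) ∘ to T-∧
    fwd weak   = Product.map₂ (Product.map₂ (to T-∧) ∘ to T-∧) ∘ to T-∧
    bwd : ∀ s → T (strictInc r₁) × T (strictInc r₂) × T (colsOK s r₁ r₂) × T (entrySetIs M (r₁ , r₂)) →
      T (check s M (r₁ , r₂))
    bwd strict (a , b , c , d) = from T-∧ (a , from T-∧ (b , from T-∧ (c , d)))
    bwd weak   (a , b , c , d) = from T-∧ (a , from T-∧ (b , from T-∧ (c , d)))

  check⇒valid : ∀ s → T (check s M (r₁ , r₂)) → Valid s M (toList r₁) (toList r₂)
  check⇒valid s t with to (check-∧ s) t
  ... | inc₁ , inc₂ , cols , set with to (T-∧ {allB (λ x → mem x (range1 M)) (entries (r₁ , r₂))}) set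
  ... | bound , cover
    with ++⁻ (toList r₁) (All.map (to ∈-range1 ∘ to (T-mem (range1 M)))
      (to (T-allB (entries (r₁ , r₂))) bound))
  ... | bound₁ , bound₂ =
    valid (to (T-strictInc r₁) inc₁) (to (T-strictInc r₂) inc₂) (to (T-colsOK s r₁ r₂) cols)
      bound₁ bound₂
      λ r → ∈-++⁻ (toList r₁) (to (T-mem _) (All.lookup (to (T-allB (range1 M)) cover) (from ∈-range1 r)))

  valid⇒check : ∀ s → Valid s M (toList r₁) (toList r₂) → T (check s M (r₁ , r₂))
  valid⇒check s (valid inc₁ inc₂ cols bound₁ bound₂ cover) =
    from (check-∧ s) (from (T-strictInc r₁) inc₁ , from (T-strictInc r₂) inc₂ ,
      from (T-colsOK s r₁ r₂) cols ,
      from T-∧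
        ( from (T-allB (entries (r₁ , r₂)))
            (All.map (from (T-mem (range1 M)) ∘ from ∈-range1) (++⁺ bound₁ bound₂))
        , from (T-allB (range1 M)) (All.tabulate λ i∈ →
            from (T-mem (entries (r₁ , r₂))) (∈-rows (cover (to ∈-range1 i∈))))))
    where
    ∈-rows : ∀ {i} → i ∈ toList r₁ ⊎ i ∈ toList r₂ → i ∈ entries (r₁ , r₂)
    ∈-rows (inj₁ p) = ∈-++⁺ˡ p
    ∈-rows (inj₂ p) = ∈-++⁺ʳ (toList r₁) p

-- Exhibits the enumerations of vectors and arrays as Cartesian products, for which uniqueness and
-- membership are known.
concatMap-map : {A B C : Set} (f : A → B → C) (xs : List A) (ys : List B) →
  concatMap (λ x → map (f x) ys) xs ≡ cartesianProductWith f xs ys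
concatMap-map f []       ys = refl
concatMap-map f (x ∷ xs) ys = cong (map (f x) ys ++_) (concatMap-map f xs ys)

allVecs-unique : ∀ M N → Unique (allVecs M N)
allVecs-unique M zero    = [] ∷ []
allVecs-unique M (suc N) = subst Unique (sym (concatMap-map _∷_ (range1 M) (allVecs M N)))
  (Unique.cartesianProductWith⁺ _∷_ ∷-injective (range1-unique M) (allVecs-unique M N))

allArrays-unique : ∀ M N → Unique (allArrays M N)
allArrays-unique M N = subst Unique (sym (concatMap-map _,_ (allVecs M N) (allVecs M N)))
  (Unique.cartesianProductWith⁺ _,_ ,-injective (allVecs-unique M N) (allVecs-unique M N))

∈-allVecs : ∀ {M N} (v : Vec ℕ N) → All (InRange M) (toList v) → v ∈ allVecs M N
∈-allVecs []      []       = here refl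
∈-allVecs {M} {suc N} (x ∷ v) (r ∷ rs) =
  subst (x ∷ v ∈_) (sym (concatMap-map _∷_ (range1 M) (allVecs M N)))
  (∈-cartesianProductWith⁺ _∷_ (from ∈-range1 r) (∈-allVecs v rs))

∈-allArrays : ∀ {M N} (r₁ r₂ : Vec ℕ N) → All (InRange M) (toList r₁) → All (InRange M) (toList r₂) →
  (r₁ , r₂) ∈ allArrays M N
∈-allArrays {M} {N} r₁ r₂ b₁ b₂ =
  subst ((r₁ , r₂) ∈_) (sym (concatMap-map _,_ (allVecs M N) (allVecs M N)))
  (∈-cartesianProductWith⁺ _,_ (∈-allVecs r₁ b₁) (∈-allVecs r₂ b₂))

-- The bijection between arrays and paths

toList-injective′ : ∀ {N} (v w : Vec ℕ N) → toList v ≡ toList w → v ≡ w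
toList-injective′ v w e = trans (sym (cast-is-id refl v)) (toList-injective refl v w e)

rows-injective : ∀ {N} {S T : Array N} → rows S ≡ rows T → S ≡ T
rows-injective {S = a , b} {c , d} e with ,-injective e
... | e₁ , e₂ = cong₂ _,_ (toList-injective′ a c e₁) (toList-injective′ b d e₂)

toVec : ∀ {N} (xs : List ℕ) → length xs ≡ N → ∃ λ (v : Vec ℕ N) → toList v ≡ xs
toVec xs refl = fromList xs , toList∘fromList xs

wordRows : ∀ {M} → Word M → List ℕ × List ℕ
wordRows w = top w , bot w

last∉ : ∀ {M xs} {ys : List ℕ} → All (InRange M) xs → ys ∷ʳ suc M ≢ xs
last∉ {ys = ys} bound refl = max∉ bound (last∈ ys)

-- The last letter can be read off from the rows that contain the largest number; two words with
-- different last letters disagree on one of these rows.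
wordRows-injective : ∀ {M} {v w : Word M} → wordRows v ≡ wordRows w → v ≡ w
wordRows-injective {v = v} {w} e = go v w (proj₁ (,-injective e)) (proj₂ (,-injective e))
  where
  go : ∀ {M} (v w : Word M) → top v ≡ top w → bot v ≡ bot w → v ≡ w
  go [] [] _ _ = refl
  go (up ∷ v)   (up ∷ w)   e e′ = cong (up ∷_) (go v w (proj₁ (∷ʳ-injective _ _ e)) e′)
  go (down ∷ v) (down ∷ w) e e′ = cong (down ∷_) (go v w e (proj₁ (∷ʳ-injective _ _ e′)))
  go (flat ∷ v) (flat ∷ w) e e′ =
    cong (flat ∷_) (go v w (proj₁ (∷ʳ-injective _ _ e)) (proj₁ (∷ʳ-injective _ _ e′)))
  go (up ∷ v)   (down ∷ w) e e′ = contradiction e (last∉ (top-bound w))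
  go (up ∷ v)   (flat ∷ w) e e′ = contradiction (sym e′) (last∉ (bot-bound v))
  go (down ∷ v) (up ∷ w)   e e′ = contradiction e′ (last∉ (bot-bound w))
  go (down ∷ v) (flat ∷ w) e e′ = contradiction (sym e) (last∉ (top-bound v))
  go (flat ∷ v) (up ∷ w)   e e′ = contradiction e′ (last∉ (bot-bound w))
  go (flat ∷ v) (down ∷ w) e e′ = contradiction e (last∉ (top-bound w))

arrays : Kind → (M N : ℕ) → List (Array N)
arrays s M N = filter (λ A → T? (check s M A)) (allArrays M N)

-- Both lists are free of duplicates and have the same members, hence are permutations of each
-- other. Arrays and words are compared through their rows as lists, the data that both types share.
arrays-↭-paths : ∀ s M N → map rows (arrays s M N) ↭ map wordRows (paths s M 0 N)
arrays-↭-paths s M N = ∼bag⇒↭ (unique∧set⇒bag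
  (Unique.map⁺ rows-injective (Unique.filter⁺ (λ A → T? (check s M A)) (allArrays-unique M N)))
  (Unique.map⁺ wordRows-injective (paths-unique s M 0 N))
  (mk⇔ fwd bwd))
  where
  fwd : ∀ {p} → p ∈ map rows (arrays s M N) → p ∈ map wordRows (paths s M 0 N)
  fwd p∈ with ∈-map⁻ rows p∈
  ... | (r₁ , r₂) , A∈ , refl
    with valid⇒path s M 0 N
      (check⇒valid M r₁ r₂ s (proj₂ (∈-filter⁻ (λ A → T? (check s M A)) {xs = allArrays M N} A∈)))
      (length-toList r₁) (length-toList r₂)
  ... | w , e₁ , e₂ , path =
    subst (_∈ map wordRows (paths s M 0 N)) (cong₂ _,_ e₁ e₂)
      (∈-map⁺ wordRows (Path⇒∈paths path))
  bwd : ∀ {p} → p ∈ map wordRows (paths s M 0 N) → p ∈ map rows (arrays s M N)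
  bwd p∈ with ∈-map⁻ wordRows p∈
  ... | w , w∈ , refl with ∈paths⇒Path s M 0 N w∈
  ... | path with toVec (top w) (top-length path) | toVec (bot w) (bot-length path) | path-valid path
  ... | r₁ , e₁ | r₂ , e₂ | v = subst (_∈ map rows (arrays s M N)) (cong₂ _,_ e₁ e₂)
    (∈-map⁺ rows (∈-filter⁺ (λ A → T? (check s M A))
      (∈-allArrays r₁ r₂ (subst (All _) (sym e₁) (top-bound w)) (subst (All _) (sym e₂) (bot-bound w)))
      (valid⇒check M r₁ r₂ s (subst₂ (Valid s M) (sym e₁) (sym e₂) v))))

-- The major index read off the word

sumTo : (ℕ → ℕ) → ℕ → ℕ
sumTo t zero    = 0
sumTo t (suc K) = t (suc K) +ℕ sumTo t K

sumTo-cong : ∀ {t t′ : ℕ → ℕ} K → (∀ {i} → i ≤ K → t i ≡ t′ i) → sumTo t K ≡ sumTo t′ K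
sumTo-cong zero    e = refl
sumTo-cong (suc K) e = cong₂ _+ℕ_ (e ≤-refl) (sumTo-cong K (e ∘ m≤n⇒m≤1+n))

sumTo-vanish : ∀ {t : ℕ → ℕ} {K} L → K ≤ L → (∀ {i} → K < i → t i ≡ 0) → sumTo t L ≡ sumTo t K
sumTo-vanish zero    z≤n z = refl
sumTo-vanish {t} (suc L) K≤L z with m≤n⇒m<n∨m≡n K≤L
... | inj₁ K<1+L = trans (cong (_+ℕ sumTo t L) (z K<1+L)) (sumTo-vanish L (m<1+n⇒m≤n K<1+L) z)
... | inj₂ refl  = refl

-- `sumTo` peels off the largest index, as a word gives up its last letter first, whereas `range1`
-- starts at 1. The summands are therefore regrouped from the other end.
sum-range1 : ∀ t K → sum (map t (range1 K)) ≡ sumTo t K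
sum-range1 t K = trans (cong (sum ∘ map t) (range1≡applyUpTo K)) (go K)
  where
  go : ∀ K → sum (map t (applyUpTo suc K)) ≡ sumTo t K
  go zero    = refl
  go (suc K) = trans (cong (sum ∘ map t) (sym (applyUpTo-∷ʳ suc K)))
    (trans (cong sum (map-++ t (applyUpTo suc K) (suc K ∷ [])))
    (trans (sum-++ (map t (applyUpTo suc K)) _)
    (trans (+ℕ-comm (sum (map t (applyUpTo suc K))) _)
    (cong₂ _+ℕ_ (+ℕ-identityʳ (t (suc K))) (go K)))))

∉⇒mem : ∀ {x xs} → x ∉ xs → mem x xs ≡ false
∉⇒mem {xs = xs} x∉ = ¬-not (x∉ ∘ to (T-mem xs) ∘ from T-≡)

mem-last : ∀ {m} xs → mem m (xs ∷ʳ m) ≡ true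
mem-last xs = to T-≡ (from (T-mem (xs ∷ʳ _)) (last∈ xs))

mem-init : ∀ {x m} xs → x ≢ m → mem x (xs ∷ʳ m) ≡ mem x xs
mem-init         []       x≢m = ∉⇒mem {xs = _ ∷ []} (λ where (here e) → x≢m e)
mem-init {x = x} (y ∷ xs) x≢m = cong ((x ≡ᵇ y) ∨_) (mem-init xs x≢m)

descent : List ℕ → List ℕ → ℕ → ℕ
descent xs ys i = if mem i xs ∧ mem (suc i) ys then i else 0

descent-cong : ∀ {xs xs′ ys ys′ i} → mem i xs ≡ mem i xs′ → mem (suc i) ys ≡ mem (suc i) ys′ →
  descent xs ys i ≡ descent xs′ ys′ i
descent-cong {i = i} = cong₂ (λ a b → if a ∧ b then i else 0)

top∌⇒descent : ∀ xs {ys i} → i ∉ xs → descent xs ys i ≡ 0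
top∌⇒descent xs {ys} {i} i∉ = cong (λ a → if a ∧ mem (suc i) ys then i else 0) (∉⇒mem i∉)

bot∌⇒descent : ∀ {xs} ys {i} → suc i ∉ ys → descent xs ys i ≡ 0
bot∌⇒descent {xs} ys {i} i∉ =
  trans (cong (λ b → if mem i xs ∧ b then i else 0) (∉⇒mem i∉))
    (cong (λ a → if a then i else 0) (∧-zeroʳ (mem i xs)))

-- Chosen so that `maj A` computes to `majRows (rows A)`.
majRows : List ℕ × List ℕ → ℕ
majRows (xs , ys) = sum (map (descent xs ys) (range1 (foldr _⊔_ 0 xs)))

above∉ : ∀ {xs i} → foldr _⊔_ 0 xs < i → i ∉ xs
above∉ {x ∷ xs} l (here refl) = <-irrefl refl (≤-<-trans (m≤m⊔n x _) l)
above∉ {x ∷ xs} l (there p)   = above∉ (≤-<-trans (m≤n⊔m x _) l) p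

max≤ : ∀ {M xs} → All (InRange M) xs → foldr _⊔_ 0 xs ≤ M
max≤ []             = z≤n
max≤ ((_ , p) ∷ ps) = ⊔-lub p (max≤ ps)

-- Putting `suc M` into row 2 can only create a descent at `M`, and does so exactly if the last
-- letter of `w` occurs in row 1.
descents-end : ∀ {M} (w : Word M) →
  sumTo (descent (top w) (bot w ∷ʳ suc M)) M ≡ endTop w +ℕ sumTo (descent (top w) (bot w)) M
descents-end [] = refl
descents-end {suc K} w@(l ∷ v) = cong₂ _+ℕ_ (at-end l) below
  where
  ys = bot w ∷ʳ suc (suc K)
  at-end : ∀ l → descent (top (l ∷ v)) (bot w ∷ʳ suc (suc K)) (suc K) ≡ endTop (l ∷ v)
  at-end down = top∌⇒descent (top v) {ys} (max∉ (top-bound v))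
  at-end up   = cong₂ (λ a b → if a ∧ b then suc K else 0) (mem-last (top v)) (mem-last (bot w))
  at-end flat = cong₂ (λ a b → if a ∧ b then suc K else 0) (mem-last (top v)) (mem-last (bot w))
  below : sumTo (descent (top w) ys) K ≡ sumTo (descent (top w) (bot w)) (suc K)
  below = trans
    (sumTo-cong K λ i≤K →
      descent-cong {top w} {top w} {ys} {bot w} refl (mem-init (bot w) (<⇒≢ (s≤s (s≤s i≤K)))))
    -- On the right the index `suc K` contributes 0, since its successor exceeds every entry of
    -- `bot w`.
    (cong (_+ℕ sumTo (descent (top w) (bot w)) K)
      (sym (bot∌⇒descent {top w} (bot w) (max∉ (bot-bound w)))))

-- The index `M` of the whole word is no descent, its successor being no entry. Below it, a last
-- letter in row 1 changes nothing, and one in row 2 adds `endTop`.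
sumTo-descent : ∀ {M} (w : Word M) → sumTo (descent (top w) (bot w)) M ≡ majW w
sumTo-descent [] = refl
sumTo-descent {suc M} (l ∷ w) =
  trans (cong (_+ℕ sumTo (descent (top (l ∷ w)) (bot (l ∷ w))) M)
          (bot∌⇒descent {top (l ∷ w)} (bot (l ∷ w)) (max∉ (bot-bound (l ∷ w)))))
        (below l)
  where
  top-init : ∀ ys → sumTo (descent (top w ∷ʳ suc M) ys) M ≡ sumTo (descent (top w) ys) M
  top-init ys = sumTo-cong M λ i≤M →
    descent-cong {top w ∷ʳ suc M} {top w} {ys} {ys} (mem-init (top w) (<⇒≢ (s≤s i≤M))) refl
  down-case : sumTo (descent (top w) (bot w ∷ʳ suc M)) M ≡ majW (down ∷ w)
  down-case = trans (descents-end w) (cong (endTop w +ℕ_) (sumTo-descent w))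
  below : ∀ l → sumTo (descent (top (l ∷ w)) (bot (l ∷ w))) M ≡ majW (l ∷ w)
  below up   = trans (top-init (bot w)) (sumTo-descent w)
  below down = down-case
  below flat = trans (top-init (bot w ∷ʳ suc M)) down-case

-- `maj` stops at the largest entry of row 1. No descent lies beyond it, so the range may be
-- extended to `M`.
majRows-word : ∀ {M} (w : Word M) → majRows (wordRows w) ≡ majW w
majRows-word {M} w = trans (sum-range1 (descent (top w) (bot w)) (foldr _⊔_ 0 (top w)))
  (trans (sym (sumTo-vanish M (max≤ (top-bound w)) (λ l → top∌⇒descent (top w) {bot w} (above∉ l))))
         (sumTo-descent w))

-- Generating functions of paths

module Sums {c ℓ : Level} (R : CommutativeRing c ℓ) where
  open CommutativeRing R hiding (zero) renaming (refl to ≈-refl; sym to ≈-sym; trans to ≈-trans)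
  open import Algebra.Properties.CommutativeSemigroup +-commutativeSemigroup using (interchange; x∙yz≈y∙xz; xy∙z≈xz∙y)
  open import Relation.Binary.Reasoning.Setoid setoid

  sumOver : {A : Set} → (A → Carrier) → List A → Carrier
  sumOver f xs = sumR R (map f xs)

  sumOver-map : {A B : Set} (f : B → Carrier) (g : A → B) (xs : List A) →
    sumOver f (map g xs) ≈ sumOver (f ∘ g) xs
  sumOver-map f g xs = reflexive (cong (sumR R) (sym (map-∘ xs)))

  sumOver-++ : {A : Set} (f : A → Carrier) (xs ys : List A) →
    sumOver f (xs ++ ys) ≈ sumOver f xs + sumOver f ys
  sumOver-++ f []       ys = ≈-sym (+-identityˡ _)
  sumOver-++ f (x ∷ xs) ys = ≈-trans (+-congˡ (sumOver-++ f xs ys)) (≈-sym (+-assoc _ _ _))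

  sumOver-* : {A : Set} (a : Carrier) {f g : A → Carrier} → (∀ x → g x ≈ a * f x) →
    (xs : List A) → sumOver g xs ≈ a * sumOver f xs
  sumOver-* a e []       = ≈-sym (zeroʳ a)
  sumOver-* a e (x ∷ xs) = ≈-trans (+-cong (e x) (sumOver-* a e xs)) (≈-sym (distribˡ a _ _))

  pow-+ : ∀ x m n → pow R x (m +ℕ n) ≈ pow R x m * pow R x n
  pow-+ x zero    n = ≈-sym (*-identityˡ _)
  pow-+ x (suc m) n = ≈-trans (*-congˡ (pow-+ x m n)) (≈-sym (*-assoc _ _ _))

  -- The shift from (h, b) to (h + 1, b - 1), with value 0 at b = 0. It is both the down term of the
  -- recurrences and the correction term between weak and strict paths.
  lower : (ℕ → ℕ → Carrier) → ℕ → ℕ → Carrier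
  lower f h zero    = 0#
  lower f h (suc b) = f (suc h) b

  -- The shape of the identity between weak sums `f` and strict sums `g`. It is preserved by sums,
  -- scalar multiples and `lower`, so it passes through the recurrences term by term.
  Splits : (f g : ℕ → ℕ → Carrier) → Set ℓ
  Splits f g = ∀ h b → f h b ≈ g h b + lower g h b

  lower-+ : ∀ f g h b → lower (λ h b → f h b + g h b) h b ≈ lower f h b + lower g h b
  lower-+ f g h zero    = ≈-sym (+-identityˡ 0#)
  lower-+ f g h (suc b) = ≈-refl

  lower-* : ∀ a f h b → lower (λ h b → a * f h b) h b ≈ a * lower f h b
  lower-* a f h zero    = ≈-sym (zeroʳ a)
  lower-* a f h (suc b) = ≈-refl

  lower-splits : ∀ {f g} → Splits f g → Splits (lower f) (lower g)
  lower-splits f~g h zero    = ≈-sym (+-identityˡ 0#)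
  lower-splits f~g h (suc b) = f~g (suc h) b

  +-splits : ∀ {f g f′ g′} → Splits f g → Splits f′ g′ →
    Splits (λ h b → f h b + f′ h b) (λ h b → g h b + g′ h b)
  +-splits {f} {g} {f′} {g′} p p′ h b = begin
    f h b + f′ h b                                        ≈⟨ +-cong (p h b) (p′ h b) ⟩
    (g h b + lower g h b) + (g′ h b + lower g′ h b)       ≈⟨ interchange _ _ _ _ ⟩
    (g h b + g′ h b) + (lower g h b + lower g′ h b)       ≈⟨ +-congˡ (lower-+ g g′ h b) ⟨
    (g h b + g′ h b) + lower (λ h b → g h b + g′ h b) h b ∎

  *-splits : ∀ a {f g} → Splits f g → Splits (λ h b → a * f h b) (λ h b → a * g h b)
  *-splits a {f} {g} p h b = begin
    a * f h b                                   ≈⟨ *-congˡ (p h b) ⟩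
    a * (g h b + lower g h b)                   ≈⟨ distribˡ a _ _ ⟩
    a * g h b + a * lower g h b                 ≈⟨ +-congˡ (lower-* a g h b) ⟨
    a * g h b + lower (λ h b → a * g h b) h b   ∎

  splits-cong : ∀ {f f′ g g′} → (∀ h b → f h b ≈ f′ h b) → (∀ h b → g h b ≈ g′ h b) →
    Splits f′ g′ → Splits f g
  splits-cong {f} {f′} {g} {g′} e e′ p h b =
    ≈-trans (e h b) (≈-trans (p h b) (+-cong (≈-sym (e′ h b)) (lower-cong b)))
    where
    lower-cong : ∀ b → lower g′ h b ≈ lower g h b
    lower-cong zero    = ≈-refl
    lower-cong (suc b) = ≈-sym (e′ (suc h) b)

  -- Recurrences and the comparison of weak with strict paths

  module PathSums (q : Carrier) where

    Z W : Kind → (M h b : ℕ) → Carrier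
    Z s M h b = sumOver (λ w → pow R q (majW w)) (paths s M h b)
    W s M h b = sumOver (λ w → pow R q (majW (down ∷ w))) (paths s M h b)

    -- `X` collects the paths whose last step is up or flat, after which a down step creates a
    -- descent. `Flat` is built from `W` because a final flat letter closes the same descent as a
    -- final down letter.
    Up Flat X : Kind → (M h b : ℕ) → Carrier
    Up s M zero    b = 0#
    Up s M (suc h) b = Z s M h b
    Flat s      M h       zero    = 0#
    Flat strict M zero    (suc b) = 0#
    Flat strict M (suc h) (suc b) = W strict M (suc h) b
    Flat weak   M h       (suc b) = W weak M h b
    X s M h b = Up s M h b + Flat s M h b

    Z-suc : ∀ s M h b → Z s (suc M) h b ≈ X s M h b + lower (W s M) h b
    Z-suc s M h b = ≈-trans
      (sumOver-++ f (endUp s M h b ++ endFlat s M h b) (endDown s M h b))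
      (+-cong (≈-trans (sumOver-++ f (endUp s M h b) (endFlat s M h b)) (+-cong (ups h) (flats s h b)))
              (downs b))
      where
      f : Word (suc M) → Carrier
      f w = pow R q (majW w)
      ups : ∀ h → sumOver f (endUp s M h b) ≈ Up s M h b
      ups zero    = ≈-refl
      ups (suc h) = sumOver-map f (up ∷_) (paths s M h b)
      flats : ∀ s h b → sumOver f (endFlat s M h b) ≈ Flat s M h b
      flats s      h       zero    = ≈-refl
      flats strict zero    (suc b) = ≈-refl
      flats strict (suc h) (suc b) = sumOver-map f (flat ∷_) (paths strict M (suc h) b)
      flats weak   h       (suc b) = sumOver-map f (flat ∷_) (paths weak M h b)
      downs : ∀ b → sumOver f (endDown s M h b) ≈ lower (W s M) h b
      downs zero    = ≈-refl
      downs (suc b) = sumOver-map f (down ∷_) (paths s M (suc h) b)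

    -- The appended down step creates a descent at `suc M` after an up or flat letter, whence the
    -- power of `q`, and none after a down letter.
    W-suc : ∀ s M h b →
      W s (suc M) h b ≈ pow R q (suc M) * X s M h b + lower (W s M) h b
    W-suc s M h b = ≈-trans
      (sumOver-++ g (endUp s M h b ++ endFlat s M h b) (endDown s M h b))
      (+-cong (≈-trans (sumOver-++ g (endUp s M h b) (endFlat s M h b))
                     (≈-trans (+-cong (ups h) (flats s h b)) (≈-sym (distribˡ _ _ _))))
              (downs b))
      where
      g : Word (suc M) → Carrier
      g w = pow R q (majW (down ∷ w))
      Q : Carrier
      Q = pow R q (suc M)
      factor : (l : Step) (f : Word M → Carrier) → (∀ w → g (l ∷ w) ≈ Q * f w) →
        ∀ ws → sumOver g (map (l ∷_) ws) ≈ Q * sumOver f ws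
      factor l f e ws = ≈-trans (sumOver-map g (l ∷_) ws) (sumOver-* Q e ws)
      ups : ∀ h → sumOver g (endUp s M h b) ≈ Q * Up s M h b
      ups zero    = ≈-sym (zeroʳ Q)
      ups (suc h) = factor up _ (λ w → pow-+ q (suc M) (majW w)) (paths s M h b)
      flats : ∀ s h b → sumOver g (endFlat s M h b) ≈ Q * Flat s M h b
      flats s      h       zero    = ≈-sym (zeroʳ Q)
      flats strict zero    (suc b) = ≈-sym (zeroʳ Q)
      flats strict (suc h) (suc b) =
        factor flat _ (λ w → pow-+ q (suc M) (majW (flat ∷ w))) (paths strict M (suc h) b)
      flats weak   h       (suc b) =
        factor flat _ (λ w → pow-+ q (suc M) (majW (flat ∷ w))) (paths weak M h b)
      downs : ∀ b → sumOver g (endDown s M h b) ≈ lower (W s M) h b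
      downs zero    = ≈-refl
      downs (suc b) = sumOver-map g (down ∷_) (paths s M (suc h) b)

    -- An up step cannot end at height 0, and strict paths have no flat step there.
    X-strict-ground : ∀ M b → X strict M zero b ≈ 0#
    X-strict-ground M zero    = +-identityˡ 0#
    X-strict-ground M (suc b) = +-identityˡ 0#

    -- A nonempty strict path at height 0 ends with a down step, after which a
    -- further down step creates no descent.
    Z≈W-ground : ∀ M b → Z strict M zero b ≈ W strict M zero b
    Z≈W-ground zero    zero    = ≈-refl
    Z≈W-ground zero    (suc b) = ≈-refl
    Z≈W-ground (suc M) b       = begin
      Z strict (suc M) 0 b                                            ≈⟨ Z-suc strict M 0 b ⟩
      X strict M 0 b + lower (W strict M) 0 b                         ≈⟨ +-congʳ X≈QX ⟩
      pow R q (suc M) * X strict M 0 b + lower (W strict M) 0 b       ≈⟨ W-suc strict M 0 b ⟨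
      W strict (suc M) 0 b                                            ∎
      where
      X≈QX : X strict M 0 b ≈ pow R q (suc M) * X strict M 0 b
      X≈QX = ≈-trans (X-strict-ground M b)
        (≈-sym (≈-trans (*-congˡ (X-strict-ground M b)) (zeroʳ _)))

    X-splits : ∀ M → Splits (Z weak M) (Z strict M) → Splits (W weak M) (W strict M) →
      Splits (X weak M) (X strict M)
    X-splits M z w zero    zero    = ≈-sym (+-identityʳ _)
    -- Here the kinds differ: the left side counts flat steps at height 0. `Z≈W-ground` turns their
    -- leading strict term into the up term of `X strict M 1 b`.
    X-splits M z w zero    (suc b) = begin
      0# + W weak M 0 b                                   ≈⟨ +-congˡ (w 0 b) ⟩
      0# + (W strict M 0 b + lower (W strict M) 0 b)      ≈⟨ +-cong (≈-sym (+-identityˡ 0#))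
                                                               (+-cong (≈-sym (Z≈W-ground M b)) (flat-lower b)) ⟩
      (0# + 0#) + (Z strict M 0 b + Flat strict M 1 b)    ∎
      where
      flat-lower : ∀ b → lower (W strict M) 0 b ≈ Flat strict M 1 b
      flat-lower zero    = ≈-refl
      flat-lower (suc b) = ≈-refl
    X-splits M z w (suc h) zero    = +-congʳ (z h 0)
    X-splits M z w (suc h) (suc b) = begin
      Z weak M h (suc b) + W weak M (suc h) b             ≈⟨ +-cong (z h (suc b)) (w (suc h) b) ⟩
      (Z strict M h (suc b) + Z strict M (suc h) b) + (W strict M (suc h) b + lower (W strict M) (suc h) b)
                                                          ≈⟨ interchange _ _ _ _ ⟩
      (Z strict M h (suc b) + W strict M (suc h) b) + (Z strict M (suc h) b + lower (W strict M) (suc h) b)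
                                                          ≈⟨ +-congˡ (+-congˡ (flat-lower b)) ⟩
      X strict M (suc h) (suc b) + X strict M (suc (suc h)) b ∎
      where
      flat-lower : ∀ b → lower (W strict M) (suc h) b ≈ Flat strict M (suc (suc h)) b
      flat-lower zero    = ≈-refl
      flat-lower (suc b) = ≈-refl

    mutual
      -- Induction on `M`, simultaneous with `W-splits` because the recurrence for `Z` involves `W`.
      -- At length 0 the correction term is always 0: it lives at positive height.
      Z-splits : ∀ M → Splits (Z weak M) (Z strict M)
      Z-splits zero    zero    zero          = ≈-sym (+-identityʳ _)
      Z-splits zero    zero    (suc b)       = ≈-sym (+-identityʳ _)
      Z-splits zero    (suc h) zero          = ≈-sym (+-identityʳ _)
      Z-splits zero    (suc h) (suc b)       = ≈-sym (+-identityʳ _)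
      Z-splits (suc M) = splits-cong (Z-suc weak M) (Z-suc strict M)
        (+-splits (X-splits M (Z-splits M) (W-splits M)) (lower-splits (W-splits M)))

      W-splits : ∀ M → Splits (W weak M) (W strict M)
      W-splits zero    zero    zero          = ≈-sym (+-identityʳ _)
      W-splits zero    zero    (suc b)       = ≈-sym (+-identityʳ _)
      W-splits zero    (suc h) zero          = ≈-sym (+-identityʳ _)
      W-splits zero    (suc h) (suc b)       = ≈-sym (+-identityʳ _)
      W-splits (suc M) = splits-cong (W-suc weak M) (W-suc strict M)
        (+-splits (*-splits _ (X-splits M (Z-splits M) (W-splits M))) (lower-splits (W-splits M)))

    -- Such a path must end with a down step from height 1. Read backwards, this returns a sum `W`
    -- at height 1 to height 0.
    Z-ground : ∀ M b → Z strict (suc M) 0 (suc b) ≈ W strict M 1 b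
    Z-ground M b = ≈-trans (Z-suc strict M 0 (suc b))
      (≈-trans (+-congʳ (X-strict-ground M (suc b))) (+-identityˡ _))

    -- The theorem for paths. The correction term `Z strict (suc M) 1 (suc b)` and the corresponding
    -- `W` differ only by the factor `Q` on `x`, and that `W` is a sum at height 0 of length one
    -- more; the difference is `(1# + - Q) * x`.
    Z-weak-recurrence : ∀ M b → Z weak (suc M) 0 (suc (suc b)) ≈
      (Z strict (suc M) 0 (suc (suc b)) + Z strict (suc (suc M)) 0 (suc (suc b)))
      + (1# + (- pow R q (suc M))) * (Z strict M 0 (suc b) + Z strict (suc M) 0 (suc b))
    Z-weak-recurrence M b = begin
      Z weak (suc M) 0 (suc (suc b))                       ≈⟨ Z-splits (suc M) 0 (suc (suc b)) ⟩
      S + Z strict (suc M) 1 (suc b)                       ≈⟨ +-congˡ (Z-suc strict M 1 (suc b)) ⟩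
      S + (x + d)                                          ≈⟨ +-congˡ (+-congʳ x≈) ⟩
      S + ((Q * x + (1# + - Q) * x) + d)                   ≈⟨ +-congˡ swap ⟩
      S + ((Q * x + d) + (1# + - Q) * x)                   ≈⟨ +-assoc _ _ _ ⟨
      (S + (Q * x + d)) + (1# + - Q) * x                   ≈⟨ +-congʳ (+-congˡ (W-suc strict M 1 (suc b))) ⟨
      -- `x` unfolds to `Z strict M 0 (suc b) + W strict M 1 b`, and `Z-ground` brings its second
      -- summand to height 0.
      (S + W strict (suc M) 1 (suc b)) + (1# + - Q) * x    ≈⟨ +-cong (+-congˡ (≈-sym (Z-ground (suc M) (suc b))))
                                                                     (*-congˡ (+-congˡ (≈-sym (Z-ground M b)))) ⟩
      (S + Z strict (suc (suc M)) 0 (suc (suc b)))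
        + (1# + - Q) * (Z strict M 0 (suc b) + Z strict (suc M) 0 (suc b)) ∎
      where
      S Q x d : Carrier
      S = Z strict (suc M) 0 (suc (suc b))
      Q = pow R q (suc M)
      x = X strict M 1 (suc b)
      d = W strict M 2 b
      swap : (Q * x + (1# + - Q) * x) + d ≈ (Q * x + d) + (1# + - Q) * x
      swap = xy∙z≈xz∙y _ _ _
      x≈ : x ≈ Q * x + (1# + - Q) * x
      x≈ = begin
        x                          ≈⟨ *-identityˡ x ⟨
        1# * x                     ≈⟨ *-congʳ (+-identityʳ 1#) ⟨
        (1# + 0#) * x              ≈⟨ *-congʳ (+-congˡ (-‿inverseʳ Q)) ⟨
        (1# + (Q + - Q)) * x       ≈⟨ *-congʳ (x∙yz≈y∙xz 1# Q (- Q)) ⟩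
        (Q + (1# + - Q)) * x       ≈⟨ distribʳ x _ _ ⟩
        Q * x + (1# + - Q) * x     ∎

-- From path sums back to arrays, and the theorem

Inc≡arrays : ∀ {N j M} → + (2 *ℕ N) -ℤ j ≡ + M → Inc N j ≡ arrays strict M N
-- `Inc` branches on the sign of its integer size, so it computes only after the rewriting.
Inc≡arrays e rewrite e = refl

RInc≡arrays : ∀ {N j M} → + (2 *ℕ N) -ℤ j ≡ + M → RInc N j ≡ arrays weak M N
RInc≡arrays e rewrite e = refl

module _ {c ℓ : Level} (R : CommutativeRing c ℓ) (q : CommutativeRing.Carrier R) where
  open CommutativeRing R hiding (zero) renaming (refl to ≈-refl; sym to ≈-sym; trans to ≈-trans)
  open Sums R
  open PathSums q

  sumR-↭ : ∀ {xs ys} → xs ↭ ys → sumR R xs ≈ sumR R ys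
  sumR-↭ p = ↭ₛ.foldr-commMonoid setoid +-isCommutativeMonoid (↭⇒↭ₛ′ isEquivalence p)

  arrays-sum : ∀ s M N → sumR R (map (λ A → pow R q (maj A)) (arrays s M N)) ≈ Z s M 0 N
  arrays-sum s M N = ≈-trans
    (reflexive (cong (sumR R) (map-∘ (arrays s M N))))
    (≈-trans (sumR-↭ (↭.map⁺ (pow R q ∘ majRows) (arrays-↭-paths s M N)))
    (reflexive (cong (sumR R) (trans (sym (map-∘ (paths s M 0 N)))
      (map-cong (λ w → cong (pow R q) (majRows-word w)) (paths s M 0 N))))))

  Sq≈Z : ∀ {N} j {M} → + (2 *ℕ N) -ℤ j ≡ + M → Sq R q N j ≈ Z strict M 0 N
  Sq≈Z {N} j {M} e =
    ≈-trans (reflexive (cong (sumR R ∘ map _) (Inc≡arrays {N} {j} e))) (arrays-sum strict M N)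

  Rq≈Z : ∀ {N} j {M} → + (2 *ℕ N) -ℤ j ≡ + M → Rq R q N j ≈ Z weak M 0 N
  Rq≈Z {N} j {M} e =
    ≈-trans (reflexive (cong (sumR R ∘ map _) (RInc≡arrays {N} {j} e))) (arrays-sum weak M N)

-- In the theorem `a` is 2(n - 1) and `suc k` is its k, so `m` is the size for (n - 1, k - 1). The
-- other three sizes are `m` plus 1 or 2.
module Sizes (a k m : ℕ) (e : a ≡ m +ℕ k) where

  +a : + a ≡ + m +ℤ + k
  +a = trans (cong +_ e) (pos-+ m k)

  sub₁ : + a -ℤ (+ suc k -ℤ + 1) ≡ + m
  sub₁ = trans (cong (_-ℤ (+ suc k -ℤ + 1)) +a) (lem (+ m) (+ k))
    where
    lem : ∀ x y → (x +ℤ y) -ℤ ((+ 1 +ℤ y) -ℤ + 1) ≡ x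
    lem = solve-∀

  sub₂ : + a -ℤ (+ suc k -ℤ + 2) ≡ + suc m
  sub₂ = trans (cong (_-ℤ (+ suc k -ℤ + 2)) +a) (lem (+ m) (+ k))
    where
    lem : ∀ x y → (x +ℤ y) -ℤ ((+ 1 +ℤ y) -ℤ + 2) ≡ + 1 +ℤ x
    lem = solve-∀

  sub₃ : + (2 +ℕ a) -ℤ + suc k ≡ + suc m
  sub₃ = trans (cong (λ x → (+ 2 +ℤ x) -ℤ + suc k) +a) (lem (+ m) (+ k))
    where
    lem : ∀ x y → (+ 2 +ℤ (x +ℤ y)) -ℤ (+ 1 +ℤ y) ≡ + 1 +ℤ x
    lem = solve-∀

  sub₄ : + (2 +ℕ a) -ℤ (+ suc k -ℤ + 1) ≡ + suc (suc m)
  sub₄ = trans (cong (λ x → (+ 2 +ℤ x) -ℤ (+ suc k -ℤ + 1)) +a) (lem (+ m) (+ k))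
    where
    lem : ∀ x y → (+ 2 +ℤ (x +ℤ y)) -ℤ ((+ 1 +ℤ y) -ℤ + 1) ≡ + 2 +ℤ x
    lem = solve-∀

theorem2p2 : {c ℓ : Level} (R : CommutativeRing c ℓ) (q : CommutativeRing.Carrier R)
    (n k : ℕ) → 0 < k → k < n →
    let open CommutativeRing R in
    Rq R q n (+ k) ≈
    (Sq R q n (+ k) + Sq R q n ((+ k) -ℤ (+ 1)))
    + ((1# + (- pow R q ((2 *ℕ n) ∸ k)))
    * (Sq R q (n ∸ 1) ((+ k) -ℤ (+ 1)) + Sq R q (n ∸ 1) ((+ k) -ℤ (+ 2))))
-- From 0 < k < n it follows that n is at least 2, so both arguments have this shape.
theorem2p2 R q (suc (suc n)) (suc k) _ (s≤s (s≤s k≤n)) = begin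
  Rq R q N (+ suc k)                ≈⟨ Rq≈Z R q {N} (+ suc k) (double (+ suc k) sub₃) ⟩
  -- The words for (n, k) have length `suc m`, hence `M` is `m`; `N` letters other than up make `b`
  -- equal to `n`.
  Z weak (suc m) 0 N                ≈⟨ Z-weak-recurrence m n ⟩
  _                                 ≈⟨ +-cong
    (+-cong (Sq≈Z R q {N} (+ suc k) (double (+ suc k) sub₃))
            (Sq≈Z R q {N} (+ suc k -ℤ + 1) (double (+ suc k -ℤ + 1) sub₄)))
    (*-cong (+-congˡ (-‿cong (reflexive (cong (pow R q) exponent))))
            (+-cong (Sq≈Z R q {suc n} (+ suc k -ℤ + 1) sub₁) (Sq≈Z R q {suc n} (+ suc k -ℤ + 2) sub₂))) ⟨
  _                                 ∎
  where
  open CommutativeRing R hiding (zero) renaming (refl to ≈-refl; sym to ≈-sym; trans to ≈-trans)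
  open Sums R
  open PathSums q
  open import Relation.Binary.Reasoning.Setoid setoid
  N a m : ℕ
  N = suc (suc n)
  a = 2 *ℕ suc n
  m = a ∸ k
  -- Makes the truncated subtraction in `m` exact.
  k≤a : k ≤ a
  k≤a = ≤-trans k≤n (≤-trans (m≤m+n n _) (n≤1+n _))
  open Sizes a k m (sym (m∸n+n≡m k≤a))
  double : ∀ i {x} → + (2 +ℕ a) -ℤ i ≡ x → + (2 *ℕ N) -ℤ i ≡ x
  double i {x} = subst (λ b → + b -ℤ i ≡ x) (sym (*-suc 2 (suc n)))
  exponent : 2 *ℕ N ∸ suc k ≡ suc m
  exponent = trans (cong (_∸ suc k) (*-suc 2 (suc n))) (+-∸-assoc 1 k≤a)
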